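{- Let $h \geq 2$ be an integer and let $t$ be an integer such that $$t \geq 1 + \frac{\log h}{\log 2}.$$ Let $\mathcal{W} = (W_i)_{i=0}^{h-1}$ be a partition of $\mathbf{N}_0$ such that, for all $i \in [0,h-1]$, there is an infinite set $\mathcal{M}_i$ of positive integers such that $$[M_i - t + 1, M_i] \subseteq W_i$$ for all $M_i \in \mathcal{M}_i$. Let $\mathcal{G} = (g_i)_{i=0}^{\infty}$ be a $\mathcal{G}$-adic sequence. Then the set $$A_{\mathcal{G}}(\mathcal{W}) = \bigcup_{i=0}^{h-1} A_{\mathcal{G}}(W_i)$$ is a minimal asymptotic basis of order $h$.
   Context: $\mathbf{N}_0 = \{0,1,2,\ldots\}$. For integers $u \le v$, $[u,v] = \{x \in \mathbf{N}_0 : u \leq x \leq v\}$. For $A \subseteq \mathbf{N}_0$ and a positive integer $h$, the $h$-fold sumset is $hA = \{a_1 + \cdots + a_h : a_i \in A \text{ for all } i = 1,\ldots,h\}$ (summands not necessarily distinct). The set $A$ is an asymptotic basis of order $h$ if $hA$ contains all sufficiently large integers. An asymptotic basis $A$ of order $h$ is minimal if no proper subset of $A$ is an asymptotic basis of order $h$. A $\mathcal{G}$-adic sequence is a strictly increasing sequence of positive integers $\mathcal{G} = (g_i)_{i=0}^{\infty}$ such that $g_0 = 1$ and $g_{i-1}$ divides $g_i$ for all $i \geq 1$. Put $d_i = g_i/g_{i-1}$ for $i \ge 1$ (so $d_i \geq 2$). For a nonempty set $W \subseteq \mathbf{N}_0$, let $\mathcal{F}^*(W)$ be the set of all nonempty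 finite subsets of $W$, and define $$A_{\mathcal{G}}(W) = \left\{ \sum_{j \in F} x_j g_j : F \in \mathcal{F}^*(W) \text{ and } x_j \in [1, d_{j+1}-1] \text{ for all } j \in F \right\}.$$ A partition of $\mathbf{N}_0$ is a sequence $\mathcal{W} = (W_i)_{i=0}^{h-1}$ of nonempty pairwise disjoint sets such that $\mathbf{N}_0 = W_0 \cup W_1 \cup \cdots \cup W_{h-1}$. -}

module Defs where

open import Data.Fin using (Fin)
open import Data.List using (List; []; map; sum)
import Data.List.Membership.Propositional as List
open import Data.List.Relation.Unary.All using (All)
open import Data.List.Relation.Unary.Unique.Propositional using (Unique)
open import Data.Nat using (ℕ; suc; pred; _+_; _*_; _∸_; _≤_; _<_; _/_; NonZero)
open import Data.Nat.Divisibility using (_∣_)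
open import Data.Product using (∃-syntax; Σ-syntax; _×_)
open import Data.Vec as Vec using (Vec)
import Data.Vec.Relation.Unary.All as VecAll
open import Level using (0ℓ)
open import Relation.Binary.PropositionalEquality using (_≡_; _≢_)
open import Relation.Nullary using (¬_)
open import Relation.Unary using (Pred; _∈_; _⊆_; _⊂_; _⊥_; ⋃; Satisfiable)

ℕSet : Set₁
ℕSet = Pred ℕ 0ℓ

[_⋯_] : ℕ → ℕ → ℕSet
[ u ⋯ v ] x = u ≤ x × x ≤ v

-- "Not finite", stated positively: every finite list omits some element of P.
Infinite : ℕSet → Set
Infinite P = (xs : List ℕ) → ∃[ m ] (m ∈ P × ¬ (m List.∈ xs))

Sumset : ℕ → ℕSet → ℕSet
Sumset h A n = Σ[ a ∈ Vec ℕ h ] (VecAll.All A a × Vec.sum a ≡ n)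

IsAsymptoticBasis : ℕ → ℕSet → Set
IsAsymptoticBasis h A = ∃[ N ] (∀ n → N ≤ n → n ∈ Sumset h A)

IsMinimalAsymptoticBasis : ℕ → ℕSet → Set₁
IsMinimalAsymptoticBasis h A =
  IsAsymptoticBasis h A × (∀ (B : ℕSet) → B ⊂ A → ¬ IsAsymptoticBasis h B)

record IsAdicSequence (g : ℕ → ℕ) : Set where
  field
    positive   : ∀ i → NonZero (g i)
    increasing : ∀ {i j} → i < j → g i < g j
    initial    : g 0 ≡ 1
    divides    : ∀ i → g i ∣ g (suc i)

  d : (i : ℕ) .{{_ : NonZero i}} → ℕ
  d i = _/_ (g i) (g (pred i)) {{positive (pred i)}}

record AdicSequence : Set where
  field
    g              : ℕ → ℕ
    isAdicSequence : IsAdicSequence g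
  open IsAdicSequence isAdicSequence public

-- A finite set F is a list without repetitions; only the values of the
-- total function x at elements of F matter.
AdicSet : AdicSequence → ℕSet → ℕSet
AdicSet 𝒢 W n =
  Σ[ F ∈ List ℕ ] Σ[ x ∈ (ℕ → ℕ) ]
    ( F ≢ [] × Unique F × All W F
    × (∀ j → j List.∈ F → x j ∈ [ 1 ⋯ d (suc j) ∸ 1 ])
    × n ≡ sum (map (λ j → x j * g j) F) )
  where open AdicSequence 𝒢

record IsPartition {h : ℕ} (W : Fin h → ℕSet) : Set where
  field
    nonempty : ∀ i → Satisfiable (W i)
    disjoint : ∀ {i j} → i ≢ j → W i ⊥ W j
    cover    : ∀ n → n ∈ ⋃ (Fin h) W

AdicUnion : AdicSequence → {h : ℕ} → (Fin h → ℕSet) → ℕSet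
AdicUnion 𝒢 {h} W = ⋃ (Fin h) (λ i → AdicSet 𝒢 (W i))

-- suc m ∸ t truncates at 0, so this is [m - t + 1, m] intersected with ℕ
-- even when m - t + 1 is negative.
Window : ℕ → ℕ → ℕSet
Window t m = [ suc m ∸ t ⋯ m ]

module Submission where

open import Defs
open import Data.Nat using (ℕ; suc; _+_; _≤_; _<_)
open import Data.Nat.Logarithm using (⌈log₂_⌉)
open import Data.Fin using (Fin)
open import Data.Product using (∃-syntax; _×_)
open import Relation.Unary using (_∈_; _⊆_)

import Data.Fin as Fin
import Data.Fin.Properties as Fin
open import Data.List using (List; []; _∷_; downFrom; filter; map)
import Data.List.Membership.Propositional as List
open import Data.List.Properties using (filter-accept; filter-reject)
import Data.List.Membership.Propositional.Properties as List
open import Data.List.Relation.Unary.All as All using (All; []; _∷_)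
import Data.List.Relation.Unary.All.Properties as All
open import Data.List.Relation.Unary.AllPairs using ([]; _∷_)
open import Data.List.Relation.Unary.Any using (here; there)
open import Data.List.Relation.Unary.Unique.Propositional using (Unique)
import Data.List.Relation.Unary.Unique.Propositional.Properties as Unique
open import Data.Nat using (zero; pred; _*_; _∸_; _^_; _/_; _%_; NonZero; z≤n; s≤s; s≤s⁻¹; _≟_; ⌈_/2⌉; ⌊_/2⌋)
open import Data.Nat.DivMod
open import Data.Nat.Divisibility using (_∣_; divides-refl; ∣-refl; ∣-trans; n∣m*n; n∣m⇒m%n≡0)
open import Data.Nat.Induction using (<-rec)
open import Data.Nat.Logarithm using (⌈log₂⌉-mono-≤; ⌈log₂⌈n/2⌉⌉≡⌈log₂n⌉∸1)
open import Data.Nat.Properties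
open import Algebra.Properties.CommutativeMonoid.Sum +-0-commutativeMonoid as Sum using (sum-remove)
open import Data.Nat.ListAction using (sum)
open import Data.Nat.Tactic.RingSolver using (solve-∀)
open import Data.Product using (∃₂; _,_; proj₁; proj₂)
open import Data.Sum using (_⊎_; inj₁; inj₂)
open import Data.Vec as Vec using (Vec; []; _∷_)
open import Data.Vec.Relation.Unary.All as VecAll using ([]; _∷_)
import Data.Vec.Relation.Unary.All.Properties as VecAll
open import Function using (_∘_)
open import Function.Definitions using (Injective)
open import Relation.Binary.Definitions using (tri<; tri≈; tri>)
open import Relation.Binary.PropositionalEquality
open import Relation.Nullary using (¬_; Dec; yes; no; contradiction; ¬?)
open import Relation.Nullary.Decidable using (decidable-stable)
open import Relation.Unary using (Decidable; ∁; ⋃; ｛_｝; _∪_; _∩_; _⊥_)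

-- Every n is a sum of at most h elements of A, one for each class of digits, and
-- every element of A other than 1 is a sum of two elements of A, so n ∈ hA once
-- h ≤ n. Conversely let a ∈ A(W i₀), and let n have the digits of a on W i₀,
-- maximal digits off W i₀ below some large position, and zeros above. In a
-- representation of n with h summands each class i ≢ i₀ must be used: otherwise
-- the window of length t in W i makes all residues too small to produce the
-- digit at its top. Removing one summand for each such class leaves one summand
-- z. The removed ones have no digits on W i₀, and no carry can occur at a
-- position where n has a maximal digit, so z has the digits of a on W i₀. As z
-- lives on a single class and a > 0, this forces z = a, so a cannot be dropped.

-- Logarithms, pigeonhole arguments and residues of sums.

-- Passing from `n` to `⌈ n /2⌉` lowers the logarithm by one. This turns the hypothesis on `t` into
-- a bound of `h` by a power of 2.
n≤2^⌈log₂n⌉ : ∀ n → n ≤ 2 ^ ⌈log₂ n ⌉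
n≤2^⌈log₂n⌉ = <-rec (λ n → n ≤ 2 ^ ⌈log₂ n ⌉) step
  where
  open ≤-Reasoning
  step : ∀ n → (∀ {m} → m < n → m ≤ 2 ^ ⌈log₂ m ⌉) → n ≤ 2 ^ ⌈log₂ n ⌉
  step 0 _ = z≤n
  step 1 _ = ≤-refl
  step n@(suc (suc k)) rec = begin
    n                              ≡⟨ ⌊n/2⌋+⌈n/2⌉≡n n ⟨
    ⌊ n /2⌋ + ⌈ n /2⌉              ≤⟨ +-monoˡ-≤ ⌈ n /2⌉ (⌊n/2⌋≤⌈n/2⌉ n) ⟩
    ⌈ n /2⌉ + ⌈ n /2⌉              ≡⟨ cong (⌈ n /2⌉ +_) (+-identityʳ ⌈ n /2⌉) ⟨
    2 * ⌈ n /2⌉                    ≤⟨ *-monoʳ-≤ 2 (rec (⌈n/2⌉<n k)) ⟩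
    2 * 2 ^ ⌈log₂ ⌈ n /2⌉ ⌉        ≡⟨ cong (λ l → 2 * 2 ^ l) (⌈log₂⌈n/2⌉⌉≡⌈log₂n⌉∸1 n) ⟩
    2 ^ (1 + (⌈log₂ n ⌉ ∸ 1))      ≡⟨ cong (2 ^_) (m+[n∸m]≡n (⌈log₂⌉-mono-≤ (s≤s (s≤s (z≤n {k}))))) ⟩
    2 ^ ⌈log₂ n ⌉                  ∎

maximum : ∀ {n} (f : Fin n → ℕ) → ∃[ b ] (∀ i → f i ≤ b)
maximum {zero}  f = 0 , λ ()
maximum {suc n} f with maximum (f ∘ Fin.suc)
... | b , f≤b = f Fin.zero + b , λ where
  Fin.zero    → m≤m+n (f Fin.zero) b
  (Fin.suc i) → ≤-trans (f≤b i) (m≤n+m b (f Fin.zero))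

-- Pigeonhole: punching out a missed `y` would inject `Fin (suc n)` into `Fin n`.
injective⇒surjective : ∀ {n} {f : Fin n → Fin n} → Injective _≡_ _≡_ f → ∀ y → ∃[ x ] f x ≡ y
injective⇒surjective {suc n} {f} inj y with Fin.any? (λ x → f x Fin.≟ y)
... | yes hit = hit
... | no miss = contradiction
  (Fin.injective⇒≤ {f = λ x → Fin.punchOut (λ eq → miss (x , sym eq))}
    (λ {x} {z} → inj ∘ Fin.punchOut-injective (λ eq → miss (x , sym eq)) (λ eq → miss (z , sym eq))))
  1+n≰n

-- Choosing a preimage of every value other than `i₀` takes up exactly `m` of the `suc m` arguments.
-- The remaining one is `k₀`; on the others `f` inverts the choice.
leftover : ∀ {m} (f : Fin (suc m) → Fin (suc m)) i₀ → (∀ i → i ≢ i₀ → ∃[ k ] f k ≡ i) →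
  ∃[ k₀ ] (Injective _≡_ _≡_ (f ∘ Fin.punchIn k₀) × (∀ q → f (Fin.punchIn k₀ q) ≢ i₀))
leftover {m} f i₀ onto = k₀ , inj , avoid
  where
  hit : ∀ p → ∃[ k ] f k ≡ Fin.punchIn i₀ p
  hit p = onto (Fin.punchIn i₀ p) (Fin.punchInᵢ≢i i₀ p)

  κ : Fin m → Fin (suc m)
  κ = proj₁ ∘ hit

  κ-injective : Injective _≡_ _≡_ κ
  κ-injective {p} {q} eq = Fin.punchIn-injective i₀ p q
    (trans (sym (proj₂ (hit p))) (trans (cong f eq) (proj₂ (hit q))))

  missed : ∃[ k ] ¬ (∃[ p ] κ p ≡ k)
  missed = Fin.¬∀⟶∃¬ (suc m) _ (λ k → Fin.any? (λ p → κ p Fin.≟ k)) λ κ-onto →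
    1+n≰n (Fin.injective⇒≤ {f = proj₁ ∘ κ-onto} λ {x} {y} eq →
      trans (sym (proj₂ (κ-onto x))) (trans (cong κ eq) (proj₂ (κ-onto y))))

  k₀ : Fin (suc m)
  k₀ = proj₁ missed

  k₀≢κ : ∀ p → k₀ ≢ κ p
  k₀≢κ p eq = proj₂ missed (p , sym eq)

  -- With `k₀` punched out, `κ` is an injective self-map of `Fin m`, so it reaches every argument
  -- other than `k₀`.
  reach : ∀ q → ∃[ p ] (Fin.punchIn k₀ q ≡ κ p)
  reach q with injective⇒surjective {f = λ p → Fin.punchOut (k₀≢κ p)}
                 (λ {x} {y} → κ-injective ∘ Fin.punchOut-injective (k₀≢κ x) (k₀≢κ y)) q
  ... | p , refl = p , Fin.punchIn-punchOut (k₀≢κ p)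

  value : ∀ q → f (Fin.punchIn k₀ q) ≡ Fin.punchIn i₀ (proj₁ (reach q))
  value q = trans (cong f (proj₂ (reach q))) (proj₂ (hit (proj₁ (reach q))))

  inj : Injective _≡_ _≡_ (f ∘ Fin.punchIn k₀)
  inj {x} {y} eq = Fin.punchIn-injective k₀ x y
    (trans (proj₂ (reach x)) (trans (cong κ p≡) (sym (proj₂ (reach y)))))
    where
    p≡ = Fin.punchIn-injective i₀ _ _ (trans (sym (value x)) (trans eq (value y)))

  avoid : ∀ q → f (Fin.punchIn k₀ q) ≢ i₀
  avoid q eq = Fin.punchInᵢ≢i i₀ _ (trans (sym (value q)) eq)

sum-lookup : ∀ {n} (v : Vec ℕ n) → Sum.sum (Vec.lookup v) ≡ Vec.sum v
sum-lookup []      = refl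
sum-lookup (x ∷ v) = cong (x +_) (sum-lookup v)

-- Each residue is at most `b ∸ 1`, and reducing the sum again only lowers it. Keeping `n` on the
-- left avoids truncated subtraction.
sum-%-bound : ∀ {n} (v : Vec ℕ n) m b .{{_ : NonZero m}} →
  (∀ k → Vec.lookup v k % m < b) → Vec.sum v % m + n ≤ n * b
sum-%-bound []      m b below = ≤-reflexive (trans (+-identityʳ _) (m*n%n≡0 0 m))
sum-%-bound {suc n} (x ∷ v) m b below = begin
  (x + Vec.sum v) % m + suc n             ≡⟨ cong (_+ suc n) (%-distribˡ-+ x (Vec.sum v) m) ⟩
  (x % m + Vec.sum v % m) % m + suc n     ≤⟨ +-monoˡ-≤ (suc n) (m%n≤m _ m) ⟩
  x % m + Vec.sum v % m + suc n           ≡⟨ rearrange (x % m) (Vec.sum v % m) n ⟩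
  suc (x % m) + (Vec.sum v % m + n)       ≤⟨ +-mono-≤ (below Fin.zero) (sum-%-bound v m b (below ∘ Fin.suc)) ⟩
  b + n * b                               ∎
  where
  open ≤-Reasoning
  rearrange : ∀ a b c → a + b + suc c ≡ suc a + (b + c)
  rearrange = solve-∀

-- `s` is `r` plus a multiple of `m`, and a nonzero multiple would already reach `r + m`.
%-unique : ∀ s r m .{{_ : NonZero m}} → s % m ≡ r → s < r + m → s ≡ r
%-unique s r m eq s<r+m with s / m | m≡m%n+[m/n]*n s m
... | zero  | s≡ = trans s≡ (trans (+-identityʳ _) eq)
... | suc q | s≡ = contradiction s<r+m (≤⇒≯ (begin
  r + m               ≤⟨ +-monoʳ-≤ r (m≤m+n m (q * m)) ⟩
  r + (m + q * m)     ≡⟨ cong (_+ (m + q * m)) eq ⟨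
  s % m + suc q * m   ≡⟨ s≡ ⟨
  s                   ∎))
  where open ≤-Reasoning

-- Digit expansions with respect to `g`.

module Expansion (𝒢 : AdicSequence) where
  open AdicSequence 𝒢

  instance
    g-nonZero : ∀ {j} → NonZero (g j)
    g-nonZero {j} = positive j

  g-suc : ∀ j → g (suc j) ≡ d (suc j) * g j
  g-suc j = sym (m/n*n≡m (divides j))

  g-<-suc : ∀ j → g j < g (suc j)
  g-<-suc j = increasing ≤-refl

  g-≤ : ∀ {i j} → i ≤ j → g i ≤ g j
  g-≤ i≤j with m≤n⇒m<n∨m≡n i≤j
  ... | inj₁ i<j  = <⇒≤ (increasing i<j)
  ... | inj₂ refl = ≤-refl

  g-∣ : ∀ {i j} → i ≤ j → g i ∣ g j
  g-∣ {i} {zero}  z≤n = ∣-refl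
  g-∣ {i} {suc j} i≤  with m≤n⇒m<n∨m≡n i≤
  ... | inj₁ (s≤s i≤j) = ∣-trans (g-∣ i≤j) (divides j)
  ... | inj₂ refl      = ∣-refl

  -- Consequently `n % g n` is `n`, so position `n` is an explicit end for the expansion of `n`.
  n<g[n] : ∀ n → n < g n
  n<g[n] zero    = ≤-reflexive (sym initial)
  n<g[n] (suc n) = ≤-trans (s≤s (n<g[n] n)) (g-<-suc n)

  1<d : ∀ j → 1 < d (suc j)
  1<d j = *-cancelʳ-< (g j) 1 (d (suc j))
    (subst₂ _<_ (sym (*-identityˡ (g j))) (g-suc j) (g-<-suc j))

  2*g≤g-suc : ∀ j → 2 * g j ≤ g (suc j)
  2*g≤g-suc j = ≤-trans (*-monoˡ-≤ (g j) (1<d j)) (≤-reflexive (sym (g-suc j)))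

  2^k*g≤g[k+s] : ∀ k s → 2 ^ k * g s ≤ g (k + s)
  2^k*g≤g[k+s] zero    s = ≤-reflexive (*-identityˡ (g s))
  2^k*g≤g[k+s] (suc k) s = begin
    2 * 2 ^ k * g s     ≡⟨ *-assoc 2 (2 ^ k) (g s) ⟩
    2 * (2 ^ k * g s)   ≤⟨ *-monoʳ-≤ 2 (2^k*g≤g[k+s] k s) ⟩
    2 * g (k + s)       ≤⟨ 2*g≤g-suc (k + s) ⟩
    g (suc k + s)       ∎
    where open ≤-Reasoning

  %-g₀ : ∀ n → n % g 0 ≡ 0
  %-g₀ n = n<1⇒n≡0 (subst (n % g 0 <_) initial (m%n<n n (g 0)))

  digit : ℕ → ℕ → ℕ
  digit j n = n % g (suc j) / g j

  digit-expand : ∀ j n → n % g (suc j) ≡ digit j n * g j + n % g j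
  digit-expand j n = begin
    n % g (suc j)                                ≡⟨ m≡m%n+[m/n]*n (n % g (suc j)) (g j) ⟩
    n % g (suc j) % g j + digit j n * g j        ≡⟨ cong (_+ digit j n * g j) (m∣n⇒o%n%m≡o%m (g j) (g (suc j)) n (divides j)) ⟩
    n % g j + digit j n * g j                    ≡⟨ +-comm (n % g j) _ ⟩
    digit j n * g j + n % g j                    ∎
    where open ≡-Reasoning

  digit<d : ∀ j n → digit j n < d (suc j)
  digit<d j n = m<n*o⇒m/o<n (subst (n % g (suc j) <_) (g-suc j) (m%n<n n (g (suc j))))

  <d⇒≤pred : ∀ {j x} → x < d (suc j) → x ≤ d (suc j) ∸ 1
  <d⇒≤pred x<d = ∸-monoˡ-≤ 1 x<d

  ≤pred⇒<d : ∀ {j x} → x ≤ d (suc j) ∸ 1 → x < d (suc j)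
  ≤pred⇒<d {j} x≤ = ≤-trans (s≤s x≤) (≤-reflexive (m+[n∸m]≡n (<⇒≤ (1<d j))))

  %-g-mono : ∀ j n → n % g j ≤ n % g (suc j)
  %-g-mono j n = ≤-trans (m≤n+m _ _) (≤-reflexive (sym (digit-expand j n)))

  -- The digit at `j` is at most `d (suc j) ∸ 1`. Equality holds exactly when the digit is maximal,
  -- and this is how maximal digits are expressed below.
  %-g-growth : ∀ j n → n % g (suc j) + g j ≤ n % g j + g (suc j)
  %-g-growth j n = begin
    n % g (suc j) + g j                          ≡⟨ cong (_+ g j) (digit-expand j n) ⟩
    digit j n * g j + n % g j + g j              ≡⟨ rearrange (digit j n * g j) (n % g j) (g j) ⟩
    n % g j + suc (digit j n) * g j              ≤⟨ +-monoʳ-≤ (n % g j) (*-monoˡ-≤ (g j) (digit<d j n)) ⟩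
    n % g j + d (suc j) * g j                    ≡⟨ cong (n % g j +_) (g-suc j) ⟨
    n % g j + g (suc j)                          ∎
    where
    open ≤-Reasoning
    rearrange : ∀ a b c → a + b + c ≡ b + (c + a)
    rearrange = solve-∀

  -- Supports of expansions and addition without carries.

  -- The digit of n at j vanishes exactly when n has the same residue modulo
  -- g j and g (suc j).
  SupportedOn : ℕSet → ℕ → Set
  SupportedOn P n = ∀ {j} → ¬ P j → n % g (suc j) ≡ n % g j

  supported-mono : ∀ {P Q n} → P ⊆ Q → SupportedOn P n → SupportedOn Q n
  supported-mono P⊆Q n∈P ¬Qj = n∈P (¬Qj ∘ P⊆Q)

  supported-0 : ∀ P → SupportedOn P 0
  supported-0 _ {j} _ = trans (m*n%n≡0 0 (g (suc j))) (sym (m*n%n≡0 0 (g j)))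

  supported-single : ∀ {m n} → g m ∣ n → n < g (suc m) → SupportedOn ｛ m ｝ n
  supported-single {m} {n} g∣n n<g {j} m≢j with <-cmp j m
  ... | tri< j<m _ _ = trans
    (n∣m⇒m%n≡0 n (g (suc j)) (∣-trans (g-∣ j<m) g∣n))
    (sym (n∣m⇒m%n≡0 n (g j) (∣-trans (g-∣ (<⇒≤ j<m)) g∣n)))
  ... | tri≈ _ j≡m _ = contradiction (sym j≡m) m≢j
  ... | tri> _ _ m<j = trans
    (m<n⇒m%n≡m (<-≤-trans n<g (≤-trans (g-≤ m<j) (<⇒≤ (g-<-suc j)))))
    (sym (m<n⇒m%n≡m (<-≤-trans n<g (g-≤ m<j))))

  -- By `%-g-growth` the residue of `x` gains no more than the modulus does, so the room left for
  -- `y` persists.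
  no-carry : ∀ {j} x {y} → x % g j + y < g j → x % g (suc j) + y < g (suc j)
  no-carry {j} x {y} small = +-cancelʳ-< (g j) _ _ (begin-strict
    x % g (suc j) + y + g j     ≡⟨ swap (x % g (suc j)) y (g j) ⟩
    x % g (suc j) + g j + y     ≤⟨ +-monoˡ-≤ y (%-g-growth j x) ⟩
    x % g j + g (suc j) + y     ≡⟨ swap (x % g j) (g (suc j)) y ⟩
    x % g j + y + g (suc j)     <⟨ +-monoˡ-< (g (suc j)) small ⟩
    g j + g (suc j)             ≡⟨ +-comm (g j) _ ⟩
    g (suc j) + g j             ∎)
    where
    open ≤-Reasoning
    swap : ∀ a b c → a + b + c ≡ a + c + b
    swap = solve-∀

  module _ {P Q : ℕSet} (P? : Decidable P) (P⊥Q : P ⊥ Q)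
           {x y} (x∈P : SupportedOn P x) (y∈Q : SupportedOn Q y) where

    -- At each position at most one of `x` and `y` has a digit, so by `no-carry` the two residues
    -- still add up to less than the modulus.
    %-additive : ∀ j → (x + y) % g j ≡ x % g j + y % g j
    %-additive zero = trans (%-g₀ (x + y)) (sym (cong₂ _+_ (%-g₀ x) (%-g₀ y)))
    %-additive (suc j) = trans (%-distribˡ-+ x y (g (suc j))) (m<n⇒m%n≡m bound)
      where
      below : x % g j + y % g j < g j
      below = subst (_< g j) (%-additive j) (m%n<n (x + y) (g j))

      bound : x % g (suc j) + y % g (suc j) < g (suc j)
      bound with P? j
      ... | yes Pj = subst (λ z → x % g (suc j) + z < g (suc j))
                       (sym (y∈Q λ Qj → P⊥Q (Pj , Qj))) (no-carry x below)
      ... | no ¬Pj = subst (λ z → z + y % g (suc j) < g (suc j)) (sym (x∈P ¬Pj))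
                       (subst (_< g (suc j)) (+-comm (y % g (suc j)) _)
                         (no-carry y (subst (_< g j) (+-comm (x % g j) _) below)))

    supported-+ : SupportedOn (P ∪ Q) (x + y)
    supported-+ {j} ¬PQj = begin
      (x + y) % g (suc j)               ≡⟨ %-additive (suc j) ⟩
      x % g (suc j) + y % g (suc j)     ≡⟨ cong₂ _+_ (x∈P (¬PQj ∘ inj₁)) (y∈Q (¬PQj ∘ inj₂)) ⟩
      x % g j + y % g j                 ≡⟨ %-additive j ⟨
      (x + y) % g j                     ∎
      where open ≡-Reasoning

    -- The residues of `x` and `y` can only grow with `j`; where their sum does not grow, neither of
    -- them does.
    summand-supportedʳ : ∀ {R} → SupportedOn R (x + y) → SupportedOn R y
    summand-supportedʳ xy∈R {j} ¬Rj = ≤-antisym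
      (+-cancelˡ-≤ (x % g j) _ _ (begin
        x % g j + y % g (suc j)           ≤⟨ +-monoˡ-≤ _ (%-g-mono j x) ⟩
        x % g (suc j) + y % g (suc j)     ≡⟨ %-additive (suc j) ⟨
        (x + y) % g (suc j)               ≡⟨ xy∈R ¬Rj ⟩
        (x + y) % g j                     ≡⟨ %-additive j ⟩
        x % g j + y % g j                 ∎))
      (%-g-mono j y)
      where open ≤-Reasoning

  supported-sum : ∀ {m} (P : Fin m → ℕSet) (e : Fin m → ℕ) → (∀ q → Decidable (P q)) →
    (∀ {p q} → p ≢ q → P p ⊥ P q) → (∀ q → SupportedOn (P q) (e q)) →
    SupportedOn (⋃ (Fin m) P) (Sum.sum e)
  supported-sum {zero}  P e P? P⊥ e∈P = supported-0 (⋃ (Fin zero) P)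
  supported-sum {suc m} P e P? P⊥ e∈P = supported-mono {Q = ⋃ (Fin (suc m)) P}
    (λ { (inj₁ Pj) → Fin.zero , Pj ; (inj₂ (q , Pj)) → Fin.suc q , Pj })
    (supported-+ (P? Fin.zero) (λ { (P₀j , q , Pqj) → P⊥ (λ ()) (P₀j , Pqj) })
      (e∈P Fin.zero)
      (supported-sum (P ∘ Fin.suc) (e ∘ Fin.suc) (P? ∘ Fin.suc)
        (λ p≢q → P⊥ (p≢q ∘ Fin.suc-injective)) (e∈P ∘ Fin.suc)))

  digit-term-< : ∀ {x} j → x < d (suc j) → x * g j < g (suc j)
  digit-term-< {x} j x<d = subst (x * g j <_) (sym (g-suc j)) (*-monoˡ-< (g j) x<d)

  supported-digit-term : ∀ {x} j → x < d (suc j) → SupportedOn ｛ j ｝ (x * g j)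
  supported-digit-term {x} j x<d = supported-single (n∣m*n x) (digit-term-< j x<d)

  -- Splitting by digits, and adic sets in terms of supports.

  module _ {P : ℕSet} (P? : Decidable P) where

    -- The digit at `k` goes to `u` or `v` according to `P? k`. The bound `_< k` in the supports
    -- keeps it apart from the digits already placed, as `supported-+` requires.
    split-below : ∀ n k → ∃₂ λ u v → u + v ≡ n % g k
      × SupportedOn (P ∩ (_< k)) u × SupportedOn (∁ P ∩ (_< k)) v
    split-below n zero = 0 , 0 , sym (%-g₀ n) , supported-0 (P ∩ (_< 0)) , supported-0 (∁ P ∩ (_< 0))
    split-below n (suc k) with split-below n k | P? k
    ... | u , v , u+v , u∈ , v∈ | yes Pk
        = digit k n * g k + u , v
        , trans (+-assoc _ u v) (trans (cong (digit k n * g k +_) u+v) (sym (digit-expand k n)))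
        , supported-mono (λ { (inj₁ refl) → Pk , ≤-refl ; (inj₂ (Pj , j<k)) → Pj , m<n⇒m<1+n j<k })
            (supported-+ (k ≟_) (λ { (refl , _ , k<k) → <-irrefl refl k<k })
              (supported-digit-term k (digit<d k n)) u∈)
        , supported-mono (λ { (¬Pj , j<k) → ¬Pj , m<n⇒m<1+n j<k }) v∈
    ... | u , v , u+v , u∈ , v∈ | no ¬Pk
        = u , digit k n * g k + v
        , trans (swap u (digit k n * g k) v) (trans (cong (digit k n * g k +_) u+v) (sym (digit-expand k n)))
        , supported-mono (λ { (Pj , j<k) → Pj , m<n⇒m<1+n j<k }) u∈
        , supported-mono (λ { (inj₁ refl) → ¬Pk , ≤-refl ; (inj₂ (¬Pj , j<k)) → ¬Pj , m<n⇒m<1+n j<k })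
            (supported-+ (k ≟_) (λ { (refl , _ , k<k) → <-irrefl refl k<k })
              (supported-digit-term k (digit<d k n)) v∈)
        where
        swap : ∀ a b c → a + (b + c) ≡ b + (a + c)
        swap = solve-∀

    split : ∀ n → ∃₂ λ u v → u + v ≡ n × SupportedOn P u × SupportedOn (∁ P) v
    split n with split-below n n
    ... | u , v , u+v , u∈ , v∈ = u , v , trans u+v (m<n⇒m%n≡m (n<g[n] n))
        , supported-mono proj₁ u∈ , supported-mono proj₁ v∈

  sum-supported : ∀ F (x : ℕ → ℕ) → Unique F → (∀ j → j List.∈ F → x j < d (suc j)) →
    SupportedOn (List._∈ F) (sum (map (λ j → x j * g j) F))
  sum-supported []      x _            _   = supported-0 (List._∈ [])
  sum-supported (j ∷ F) x (j∉F ∷ uniq) x<d = supported-mono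
    (λ { (inj₁ refl) → here refl ; (inj₂ k∈F) → there k∈F })
    (supported-+ (j ≟_) (λ { (refl , j∈F) → All.lookup j∉F j∈F refl })
      (supported-digit-term j (x<d j (here refl)))
      (sum-supported F x uniq λ k k∈F → x<d k (there k∈F)))

  adic⇒supported : ∀ {W n} → AdicSet 𝒢 W n → SupportedOn W n
  adic⇒supported (F , x , _ , uniq , F⊆W , x-range , refl) = supported-mono (All.lookup F⊆W)
    (sum-supported F x uniq λ j j∈F → ≤pred⇒<d (proj₂ (x-range j j∈F)))

  adic⇒positive : ∀ {W n} → AdicSet 𝒢 W n → 0 < n
  adic⇒positive ([] , _ , F≢[] , _) = contradiction refl F≢[]
  adic⇒positive (j ∷ F , x , _ , _ , _ , x-range , refl) =
    ≤-trans (*-mono-≤ (proj₁ (x-range j (here refl))) (≤-trans (s≤s z≤n) (n<g[n] j))) (m≤m+n _ _)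

  digit-zero : ∀ j n → n % g (suc j) ≡ n % g j → digit j n ≡ 0
  digit-zero j n eq = m*n≡0⇒m≡0 (digit j n) (g j)
    (+-cancelʳ-≡ (n % g j) _ 0 (trans (sym (digit-expand j n)) eq))

  -- The witness is the expansion of `n` itself, restricted to its nonzero digits. Together with the
  -- two preceding converses this lets residues replace explicit finite sums.
  supported⇒adic : ∀ {W n} → Decidable W → 0 < n → SupportedOn W n → AdicSet 𝒢 W n
  supported⇒adic {W} {n} W? 0<n n∈W = F n , (λ j → digit j n)
    , (λ F≡[] → <⇒≢ 0<n (trans (cong (sum ∘ map term) (sym F≡[])) sum-F))
    , Unique.filter⁺ nonzero? (Unique.downFrom⁺ n)
    , All.map (λ {j} digit≢0 → decidable-stable (W? j) λ ¬Wj → digit≢0 (digit-zero j n (n∈W ¬Wj)))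
        (digits≢0 n)
    , (λ j j∈F → n≢0⇒n>0 (All.lookup (digits≢0 n) j∈F) , <d⇒≤pred (digit<d j n))
    , sym sum-F
    where
    nonzero? : Decidable (λ j → digit j n ≢ 0)
    nonzero? j = ¬? (digit j n ≟ 0)

    term : ℕ → ℕ
    term j = digit j n * g j

    F : ℕ → List ℕ
    F k = filter nonzero? (downFrom k)

    digits≢0 : ∀ k → All (λ j → digit j n ≢ 0) (F k)
    digits≢0 k = All.all-filter nonzero? (downFrom k)

    sum-below : ∀ k → sum (map term (F k)) ≡ n % g k
    sum-below zero = sym (%-g₀ n)
    sum-below (suc k) with digit k n ≟ 0
    ... | yes digit≡0 = begin
      sum (map term (F (suc k)))     ≡⟨ cong (sum ∘ map term) (filter-reject nonzero? (λ ≢0 → ≢0 digit≡0)) ⟩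
      sum (map term (F k))           ≡⟨ sum-below k ⟩
      n % g k                        ≡⟨ cong (λ x → x * g k + n % g k) digit≡0 ⟨
      digit k n * g k + n % g k      ≡⟨ digit-expand k n ⟨
      n % g (suc k)                  ∎
      where open ≡-Reasoning
    ... | no digit≢0 = begin
      sum (map term (F (suc k)))     ≡⟨ cong (sum ∘ map term) (filter-accept nonzero? digit≢0) ⟩
      term k + sum (map term (F k))  ≡⟨ cong (term k +_) (sum-below k) ⟩
      digit k n * g k + n % g k      ≡⟨ digit-expand k n ⟨
      n % g (suc k)                  ∎
      where open ≡-Reasoning

    sum-F : sum (map term (F n)) ≡ n
    sum-F = trans (sum-below n) (m<n⇒m%n≡m (n<g[n] n))

  -- Comparing two decompositions against maximal digits.

  -- The digits of e off P are all maximal, so any further digit there would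
  -- carry; hence the digits of z on P have to be those of a.
  module _ {P : ℕSet} (P? : Decidable P) {a e k : ℕ}
           (a∈P : SupportedOn P a) (e∉P : SupportedOn (∁ P) e)
           (e-maximal : ∀ {j} → ¬ P j → j < k → e % g (suc j) + g j ≡ e % g j + g (suc j))
           (a<g : a < g k) (e<g : e < g k) where

    private
      additive : ∀ j → (a + e) % g j ≡ a % g j + e % g j
      additive = %-additive P? (λ { (Pj , ¬Pj) → ¬Pj Pj }) a∈P e∉P

    a+e<g : a + e < g k
    a+e<g = subst (_< g k)
      (trans (additive k) (cong₂ _+_ (m<n⇒m%n≡m a<g) (m<n⇒m%n≡m e<g)))
      (m%n<n (a + e) (g k))

    a+e-maximal : ∀ {j} → ¬ P j → j < k →
      (a + e) % g (suc j) + g j ≡ (a + e) % g j + g (suc j)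
    a+e-maximal {j} ¬Pj j<k = begin
      (a + e) % g (suc j) + g j               ≡⟨ cong (_+ g j) (additive (suc j)) ⟩
      a % g (suc j) + e % g (suc j) + g j     ≡⟨ +-assoc (a % g (suc j)) _ _ ⟩
      a % g (suc j) + (e % g (suc j) + g j)   ≡⟨ cong₂ _+_ (a∈P ¬Pj) (e-maximal ¬Pj j<k) ⟩
      a % g j + (e % g j + g (suc j))         ≡⟨ +-assoc (a % g j) _ _ ⟨
      a % g j + e % g j + g (suc j)           ≡⟨ cong (_+ g (suc j)) (additive j) ⟨
      (a + e) % g j + g (suc j)               ∎
      where open ≡-Reasoning

    module _ {z f : ℕ} (f∉P : SupportedOn (∁ P) f) (z+f≡a+e : z + f ≡ a + e) where

      private
        -- On `P` only `z` can have a digit. Off `P` the residues of `z` and `f` together gain at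
        -- most twice `g (suc j) ∸ g j`, while that of `a + e` gains it once. So `S` exceeds the
        -- residue of `a + e` by less than the modulus, and being congruent to it, equals it.
        no-carry-below : ∀ j → j ≤ k → z % g j + f % g j ≡ (a + e) % g j
        no-carry-below zero    _   = trans (cong₂ _+_ (%-g₀ z) (%-g₀ f)) (sym (%-g₀ (a + e)))
        no-carry-below (suc j) j<k = by-position (P? j)
          where
          S = z % g (suc j) + f % g (suc j)

          IH : z % g j + f % g j ≡ (a + e) % g j
          IH = no-carry-below j (<⇒≤ j<k)

          S≡ : S % g (suc j) ≡ (a + e) % g (suc j)
          S≡ = trans (sym (%-distribˡ-+ z f (g (suc j)))) (cong (_% g (suc j)) z+f≡a+e)

          by-position : Dec (P j) → S ≡ (a + e) % g (suc j)
          by-position (yes Pj) = trans (sym (m<n⇒m%n≡m S<g)) S≡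
            where
            S<g : S < g (suc j)
            S<g = subst (λ x → z % g (suc j) + x < g (suc j)) (sym (f∉P (λ ¬Pj → ¬Pj Pj)))
              (no-carry z (subst (_< g j) (sym IH) (m%n<n (a + e) (g j))))
          -- Adding `g j` twice allows `%-g-growth` to be applied to both `z` and `f`.
          by-position (no ¬Pj) = %-unique S _ (g (suc j)) S≡ (+-cancelʳ-< (g j + g j) _ _ (begin-strict
            S + (g j + g j)
              ≡⟨ interchange (z % g (suc j)) (f % g (suc j)) (g j) (g j) ⟩
            (z % g (suc j) + g j) + (f % g (suc j) + g j)
              ≤⟨ +-mono-≤ (%-g-growth j z) (%-g-growth j f) ⟩
            (z % g j + g (suc j)) + (f % g j + g (suc j))
              ≡⟨ regroup (z % g j) (f % g j) (g (suc j)) ⟩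
            (z % g j + f % g j) + g (suc j) + g (suc j)
              ≡⟨ cong (λ x → x + g (suc j) + g (suc j)) IH ⟩
            (a + e) % g j + g (suc j) + g (suc j)
              ≡⟨ cong (_+ g (suc j)) (a+e-maximal ¬Pj j<k) ⟨
            (a + e) % g (suc j) + g j + g (suc j)
              <⟨ m<m+n _ (≤-trans (s≤s z≤n) (n<g[n] j)) ⟩
            (a + e) % g (suc j) + g j + g (suc j) + g j
              ≡⟨ collect ((a + e) % g (suc j)) (g j) (g (suc j)) ⟩
            (a + e) % g (suc j) + g (suc j) + (g j + g j) ∎))
            where
            open ≤-Reasoning
            interchange : ∀ a b c d → a + b + (c + d) ≡ (a + c) + (b + d)
            interchange = solve-∀
            regroup : ∀ a b c → (a + c) + (b + c) ≡ (a + b) + c + c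
            regroup = solve-∀
            collect : ∀ a b c → a + b + c + b ≡ a + c + (b + b)
            collect = solve-∀

        -- Neither `e` nor `f` has a digit at a position of `P`, so without carries the digit of the
        -- sum there belongs to `a` and equally to `z`.
        digits-agree : ∀ {j} → j < k → P j → z % g (suc j) + a % g j ≡ a % g (suc j) + z % g j
        digits-agree {j} j<k Pj = +-cancelʳ-≡ (f % g j + e % g j) _ _ (begin
          z % g (suc j) + a % g j + (f % g j + e % g j)
            ≡⟨ interchange (z % g (suc j)) (a % g j) (f % g j) (e % g j) ⟩
          (z % g (suc j) + f % g j) + (a % g j + e % g j)
            ≡⟨ cong₂ _+_ above (trans (sym (additive j)) (sym (no-carry-below j (<⇒≤ j<k)))) ⟩
          (a % g (suc j) + e % g j) + (z % g j + f % g j)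
            ≡⟨ interchange′ (a % g (suc j)) (e % g j) (z % g j) (f % g j) ⟩
          a % g (suc j) + z % g j + (f % g j + e % g j) ∎)
          where
          open ≡-Reasoning
          off : ∀ {n} → SupportedOn (∁ P) n → n % g (suc j) ≡ n % g j
          off n∉P = n∉P (λ ¬Pj → ¬Pj Pj)

          above : z % g (suc j) + f % g j ≡ a % g (suc j) + e % g j
          above = begin
            z % g (suc j) + f % g j          ≡⟨ cong (z % g (suc j) +_) (off {f} f∉P) ⟨
            z % g (suc j) + f % g (suc j)    ≡⟨ no-carry-below (suc j) j<k ⟩
            (a + e) % g (suc j)              ≡⟨ additive (suc j) ⟩
            a % g (suc j) + e % g (suc j)    ≡⟨ cong (a % g (suc j) +_) (off {e} e∉P) ⟩
            a % g (suc j) + e % g j          ∎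

          interchange : ∀ a b c d → a + b + (c + d) ≡ (a + c) + (b + d)
          interchange = solve-∀
          interchange′ : ∀ a b c d → (a + b) + (c + d) ≡ a + c + (d + b)
          interchange′ = solve-∀

      summand-on-P : SupportedOn P z → z ≡ a
      summand-on-P z∈P = trans (sym (m<n⇒m%n≡m z<g)) (trans (agree k ≤-refl) (m<n⇒m%n≡m a<g))
        where
        z<g : z < g k
        z<g = ≤-<-trans (≤-trans (m≤m+n z f) (≤-reflexive z+f≡a+e)) a+e<g

        agree : ∀ j → j ≤ k → z % g j ≡ a % g j
        agree zero    _   = trans (%-g₀ z) (sym (%-g₀ a))
        agree (suc j) j<k with P? j
        ... | yes Pj = +-cancelʳ-≡ (a % g j) _ _
          (trans (digits-agree j<k Pj) (cong (a % g (suc j) +_) (agree j (<⇒≤ j<k))))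
        ... | no ¬Pj = trans (z∈P ¬Pj) (trans (agree j (<⇒≤ j<k)) (sym (a∈P ¬Pj)))

      -- If `z` has no digits on `P`, then `digits-agree` leaves none for `a` there, and `a` has
      -- none elsewhere.
      summand-off-P : SupportedOn (∁ P) z → a ≡ 0
      summand-off-P z∉P = trans (sym (m<n⇒m%n≡m a<g)) (vanish k ≤-refl)
        where
        vanish : ∀ j → j ≤ k → a % g j ≡ 0
        vanish zero    _   = %-g₀ a
        vanish (suc j) j<k with P? j
        ... | yes Pj = trans
          (+-cancelʳ-≡ (z % g j) _ _ (begin
            a % g (suc j) + z % g j   ≡⟨ digits-agree j<k Pj ⟨
            z % g (suc j) + a % g j   ≡⟨ cong (_+ a % g j) (z∉P (λ ¬Pj → ¬Pj Pj)) ⟩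
            z % g j + a % g j         ≡⟨ +-comm (z % g j) _ ⟩
            a % g j + z % g j         ∎))
          (vanish j (<⇒≤ j<k))
          where open ≡-Reasoning
        ... | no ¬Pj = trans (a∈P ¬Pj) (vanish j (<⇒≤ j<k))

  -- Constant residues and numbers with maximal digits.

  %-g-constant : ∀ n k s → (∀ {j} → s ≤ j → j < k + s → n % g (suc j) ≡ n % g j) →
    n % g (k + s) ≡ n % g s
  %-g-constant n zero    s unchanged = refl
  %-g-constant n (suc k) s unchanged = trans (unchanged (m≤n+m s k) ≤-refl)
    (%-g-constant n k s λ s≤j j<k+s → unchanged s≤j (m<n⇒m<1+n j<k+s))

  pred-% : ∀ {m n} .{{_ : NonZero m}} .{{_ : NonZero n}} → m ∣ n → suc (pred n % m) ≡ m
  pred-% {suc m} (divides-refl (suc q)) = cong suc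
    (trans ([m+kn]%n≡m%n m q (suc m)) (m<n⇒m%n≡m ≤-refl))

  -- `pred (g k)` is congruent to -1 modulo every `g j` with `j ≤ k`, so all its digits below `k`
  -- are maximal; `e` is its part off `P`.
  maximal-complement : ∀ {P} → Decidable P → ∀ k → ∃[ e ] (e < g k × SupportedOn (∁ P) e
    × (∀ {j} → ¬ P j → j < k → e % g (suc j) + g j ≡ e % g j + g (suc j)))
  maximal-complement {P} P? k with split P? (pred (g k))
  ... | u , e , u+e , u∈P , e∉P = e
      , ≤-<-trans (≤-trans (m≤n+m e u) (≤-reflexive u+e)) (≤-reflexive (suc-pred (g k)))
      , e∉P , maximal
    where
    g≡ : ∀ {j} → j ≤ k → suc (u % g j + e % g j) ≡ g j
    g≡ {j} j≤k = begin
      suc (u % g j + e % g j)  ≡⟨ cong suc (%-additive P? (λ { (Pj , ¬Pj) → ¬Pj Pj }) u∈P e∉P j) ⟨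
      suc ((u + e) % g j)      ≡⟨ cong (λ n → suc (n % g j)) u+e ⟩
      suc (pred (g k) % g j)   ≡⟨ pred-% (g-∣ j≤k) ⟩
      g j                      ∎
      where open ≡-Reasoning

    maximal : ∀ {j} → ¬ P j → j < k → e % g (suc j) + g j ≡ e % g j + g (suc j)
    maximal {j} ¬Pj j<k = begin
      e % g (suc j) + g j
        ≡⟨ cong (e % g (suc j) +_) (g≡ (<⇒≤ j<k)) ⟨
      e % g (suc j) + suc (u % g j + e % g j)
        ≡⟨ swap (e % g (suc j)) (u % g j) (e % g j) ⟩
      e % g j + suc (u % g j + e % g (suc j))
        ≡⟨ cong (λ x → e % g j + suc (x + e % g (suc j))) (u∈P ¬Pj) ⟨
      e % g j + suc (u % g (suc j) + e % g (suc j))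
        ≡⟨ cong (e % g j +_) (g≡ j<k) ⟩
      e % g j + g (suc j) ∎
      where
      open ≡-Reasoning
      swap : ∀ a b c → a + suc (b + c) ≡ c + suc (b + a)
      swap = solve-∀

-- The asymptotic basis property.

module Partition (𝒢 : AdicSequence) {h : ℕ} (W : Fin h → ℕSet) (W-partition : IsPartition W) where
  open AdicSequence 𝒢 using (g; d)
  open Expansion 𝒢
  open IsPartition W-partition

  A : ℕSet
  A = AdicUnion 𝒢 W

  W? : ∀ i → Decidable (W i)
  W? i j with cover j
  ... | i′ , W′j with i Fin.≟ i′
  ...   | yes refl = yes W′j
  ...   | no  i≢i′ = no λ Wj → disjoint i≢i′ (Wj , W′j)

  digit-term∈A : ∀ {x} j → 0 < x → x < d (suc j) → A (x * g j)
  digit-term∈A {x} j 0<x x<d with cover j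
  ... | i , Wj = i , supported⇒adic (W? i) (*-mono-≤ 0<x (≤-trans (s≤s z≤n) (n<g[n] j)))
    (supported-mono (λ { refl → Wj }) (supported-digit-term j x<d))

  -- A lone digit 1 at suc j is split using g (suc j) = g j + (d (suc j) ∸ 1) * g j.
  split-element : ∀ {n} → A n → n ≡ 1 ⊎ (∃₂ λ b c → A b × A c × n ≡ b + c)
  split-element (i , [] , _ , F≢[] , _) = contradiction refl F≢[]
  split-element (i , j ∷ F@(_ ∷ _) , x , _ , _ ∷ uniq , _ ∷ F⊆W , x-range , refl) =
    inj₂ (_ , _
      , digit-term∈A j (proj₁ (x-range j (here refl))) (≤pred⇒<d (proj₂ (x-range j (here refl))))
      , (i , F , x , (λ ()) , uniq , F⊆W , (λ k k∈F → x-range k (there k∈F)) , refl)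
      , refl)
  split-element (i , j ∷ [] , x , _ , _ , _ , x-range , refl)
    with x j | x-range j (here refl)
  ... | suc (suc y) | _ , y≤ = inj₂ (1 * g j , suc y * g j
      , digit-term∈A j (s≤s z≤n) (1<d j)
      , digit-term∈A j (s≤s z≤n) (<⇒≤ (≤pred⇒<d {j} y≤))
      , rearrange (g j) y)
    where
    rearrange : ∀ b y → suc (suc y) * b + 0 ≡ 1 * b + suc y * b
    rearrange = solve-∀
  split-element (i , zero ∷ [] , x , _ , _ , _ , x-range , refl)
    | suc zero | _ = inj₁ (cong (λ y → y + 0 + 0) initial)
    where open AdicSequence 𝒢 using (initial)
  split-element (i , suc j ∷ [] , x , _ , _ , _ , x-range , refl)
    | suc zero | _ = inj₂ (1 * g j , (d (suc j) ∸ 1) * g j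
      , digit-term∈A j ≤-refl (1<d j)
      , digit-term∈A j (∸-monoˡ-≤ 1 (1<d j)) (≤pred⇒<d {j} ≤-refl)
      , (begin
          g (suc j) + 0 + 0                  ≡⟨ trans (+-identityʳ _) (+-identityʳ _) ⟩
          g (suc j)                          ≡⟨ g-suc j ⟩
          d (suc j) * g j                    ≡⟨ cong (_* g j) (m+[n∸m]≡n (<⇒≤ (1<d j))) ⟨
          (1 + (d (suc j) ∸ 1)) * g j        ≡⟨ *-distribʳ-+ (g j) 1 (d (suc j) ∸ 1) ⟩
          1 * g j + (d (suc j) ∸ 1) * g j    ∎))
    where open ≡-Reasoning

  sumset-cons : ∀ {k a n} → A a → Sumset k A n → Sumset (suc k) A (a + n)
  sumset-cons {a = a} a∈A (v , v∈A , refl) = a ∷ v , a∈A ∷ v∈A , refl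

  -- Since `k < n`, the `k` summands cannot all be 1; the first one that is not is replaced by two.
  extend : ∀ {k n} → Sumset k A n → k < n → Sumset (suc k) A n
  extend ([] , [] , refl) ()
  extend {suc k} (a ∷ v , a∈A ∷ v∈A , refl) k<n with split-element a∈A
  ... | inj₂ (b , c , b∈A , c∈A , refl) =
    b ∷ c ∷ v , b∈A ∷ c∈A ∷ v∈A , sym (+-assoc b c (Vec.sum v))
  ... | inj₁ refl = sumset-cons a∈A (extend (v , v∈A , refl) (s≤s⁻¹ k<n))

  fill : ∀ i {k n} → Sumset k A n → i + k ≤ n → Sumset (i + k) A n
  fill zero    n∈ _ = n∈
  fill (suc i) n∈ i+k<n = extend (fill i n∈ (<⇒≤ i+k<n)) i+k<n

  below : ℕ → ℕSet
  below m j = ∃[ i ] (Fin.toℕ i < m × W i j)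

  -- The part of `n` on the last class is split off. It is an element of `A` or 0, and in the latter
  -- case contributes no summand, hence `k ≤ m` rather than equality.
  peel : ∀ m → m ≤ h → ∀ {n} → SupportedOn (below m) n → ∃[ k ] (k ≤ m × Sumset k A n)
  peel zero _ {n} n∈ = 0 , z≤n , [] , [] , sym (trans (sym (m<n⇒m%n≡m (n<g[n] n))) (vanish n))
    where
    vanish : ∀ k → n % g k ≡ 0
    vanish zero    = %-g₀ n
    vanish (suc k) = trans (n∈ λ { (_ , () , _) }) (vanish k)
  peel (suc m) m<h {n} n∈ with split (W? (Fin.fromℕ< m<h)) n
  ... | u , v , refl , u∈W , v∉W = add-class (peel m (<⇒≤ m<h) v-below)
    where
    i = Fin.fromℕ< m<h

    v-below : SupportedOn (below m) v
    v-below {j} ¬below with W? i j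
    ... | yes Wj = v∉W λ ¬Wj → ¬Wj Wj
    ... | no ¬Wj = summand-supportedʳ (W? i) (λ { (Wj , ¬Wj) → ¬Wj Wj }) u∈W v∉W
                     {R = below (suc m)} n∈ λ { (i′ , s≤s i′≤m , W′j) → absurd i′ W′j (m≤n⇒m<n∨m≡n i′≤m) }
      where
      absurd : ∀ i′ → W i′ j → Fin.toℕ i′ < m ⊎ Fin.toℕ i′ ≡ m → _
      absurd i′ W′j (inj₁ i′<m) = ¬below (i′ , i′<m , W′j)
      absurd i′ W′j (inj₂ i′≡m) = ¬Wj (subst (λ i → W i j)
        (Fin.toℕ-injective (trans i′≡m (sym (Fin.toℕ-fromℕ< m<h)))) W′j)

    add-class : ∃[ k ] (k ≤ m × Sumset k A v) → ∃[ k ] (k ≤ suc m × Sumset k A (u + v))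
    add-class (k , k≤m , v∈) with u ≟ 0
    ... | yes refl = k , m≤n⇒m≤1+n k≤m , v∈
    ... | no  u≢0  = suc k , s≤s k≤m
      , sumset-cons (i , supported⇒adic (W? i) (n≢0⇒n>0 u≢0) u∈W) v∈

  isAsymptoticBasis : IsAsymptoticBasis h A
  -- The threshold `h` is what `fill` needs to reach `h` summands.
  isAsymptoticBasis = h , λ n h≤n → from-peel n h≤n
    (peel h ≤-refl λ {j} ¬covered → contradiction
      (proj₁ (cover j) , Fin.toℕ<n _ , proj₂ (cover j)) ¬covered)
    where
    from-peel : ∀ n → h ≤ n → ∃[ k ] (k ≤ h × Sumset k A n) → Sumset h A n
    from-peel n h≤n (k , k≤h , n∈) = subst (λ l → Sumset l A n) (m∸n+n≡m k≤h)
      (fill (h ∸ k) n∈ (≤-trans (≤-reflexive (m∸n+n≡m k≤h)) h≤n))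

-- Minimality.

infinite⇒unbounded : ∀ {P} → Infinite P → ∀ b → ∃[ m ] (P m × b ≤ m)
infinite⇒unbounded inf b with inf (downFrom b)
... | m , Pm , m∉ = m , Pm , ≮⇒≥ (m∉ ∘ List.∈-downFrom⁺)

-- Here `t` is one less than in the theorem, so `Window (suc t) m` runs from `m ∸ t` to `m`.
module Minimality (𝒢 : AdicSequence) {h′ : ℕ}
  (W : Fin (suc (suc h′)) → ℕSet) (W-partition : IsPartition W)
  (t : ℕ) (log₂h≤t : ⌈log₂ suc (suc h′) ⌉ ≤ t)
  (windows : ∀ i → ∃[ M ] (Infinite M × (∀ m → m ∈ M → 0 < m × Window (suc t) m ⊆ W i)))
  where
  open AdicSequence 𝒢 using (g)
  open Expansion 𝒢
  open IsPartition W-partition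
  open Partition 𝒢 W W-partition

  private
    h : ℕ
    h = suc (suc h′)

  late-window : ∀ b i → ∃[ m ] (b ≤ m × Window (suc t) m ⊆ W i)
  late-window b i with windows i
  ... | M , M-infinite , M-window with infinite⇒unbounded M-infinite b
  ...   | m , m∈M , b≤m = m , b≤m , proj₂ (M-window m m∈M)

  -- If no summand is supported on the class W i containing a window with top m,
  -- then modulo g (suc m) each is below g (m ∸ t), too small for h of them to reach g m.
  class-used : ∀ {i m} (v : Vec ℕ h) (cls : Fin h → Fin h) →
    (∀ k → SupportedOn (W (cls k)) (Vec.lookup v k)) → t ≤ m → Window (suc t) m ⊆ W i →
    g m ≤ Vec.sum v % g (suc m) → ∃[ k ] cls k ≡ i
  class-used {i} {m} v cls v∈W t≤m window high with Fin.any? (λ k → cls k Fin.≟ i)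
  ... | yes used = used
  ... | no unused = contradiction small (<⇒≱ (begin-strict
    g m                              ≤⟨ high ⟩
    Vec.sum v % g (suc m)            <⟨ m<m+n _ (s≤s z≤n) ⟩
    Vec.sum v % g (suc m) + h        ∎))
    where
    open ≤-Reasoning
    s = m ∸ t

    unchanged : ∀ k {j} → s ≤ j → j < suc t + s →
      Vec.lookup v k % g (suc j) ≡ Vec.lookup v k % g j
    unchanged k s≤j j< = v∈W k λ Wj → disjoint (λ eq → unused (k , eq))
      (Wj , window (s≤j , subst (_ ≤_) (m+[n∸m]≡n t≤m) (s≤s⁻¹ j<)))

    residue : ∀ k → Vec.lookup v k % g (suc m) < g s
    residue k = subst (_< g s)
      (trans (sym (%-g-constant (Vec.lookup v k) (suc t) s (unchanged k)))
        (cong (λ j → Vec.lookup v k % g (suc j)) (m+[n∸m]≡n t≤m)))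
      (m%n<n (Vec.lookup v k) (g s))

    small : Vec.sum v % g (suc m) + h ≤ g m
    small = begin
      Vec.sum v % g (suc m) + h    ≤⟨ sum-%-bound v (g (suc m)) (g s) residue ⟩
      -- The bound on `t` enters here, as `h ≤ 2 ^ t`; each of the `t` steps from `s` to `m` then at
      -- least doubles `g`.
      h * g s                      ≤⟨ *-monoˡ-≤ (g s) (≤-trans (n≤2^⌈log₂n⌉ h) (^-monoʳ-≤ 2 log₂h≤t)) ⟩
      2 ^ t * g s                  ≤⟨ 2^k*g≤g[k+s] t s ⟩
      g (t + s)                    ≡⟨ cong g (m+[n∸m]≡n t≤m) ⟩
      g m                          ∎

  -- The number to be represented is `a + e`, where `L` lies above all the chosen window tops `M i`,
  -- and `b` is the threshold to be reached.
  module _ {i₀ : Fin h} {a : ℕ} (a∈ : AdicSet 𝒢 (W i₀) a) (b : ℕ)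
           (M : Fin h → ℕ) (t+b≤M : ∀ i → t + b ≤ M i) (M-window : ∀ i → Window (suc t) (M i) ⊆ W i)
           {L e : ℕ} (M<L : ∀ i → M i < L) (a<g : a < g L)
           (e<g : e < g L) (e∉W : SupportedOn (∁ (W i₀)) e)
           (e-maximal : ∀ {j} → ¬ W i₀ j → j < L → e % g (suc j) + g j ≡ e % g j + g (suc j)) where

    private
      a∈W : SupportedOn (W i₀) a
      a∈W = adic⇒supported a∈

      -- `M i` lies in its own window, hence off `W i₀`, where the digit of `a + e` is maximal and
      -- so nonzero.
      high : ∀ {i} → i ≢ i₀ → g (M i) ≤ (a + e) % g (suc (M i))
      high {i} i≢i₀ = +-cancelʳ-≤ (g (M i)) _ _ (begin
        g (M i) + g (M i)                     ≡⟨ cong (g (M i) +_) (+-identityʳ _) ⟨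
        2 * g (M i)                           ≤⟨ 2*g≤g-suc (M i) ⟩
        g (suc (M i))                         ≤⟨ m≤n+m _ _ ⟩
        (a + e) % g (M i) + g (suc (M i))     ≡⟨ a+e-maximal (W? i₀) a∈W e∉W e-maximal a<g e<g M∉W₀ (M<L i) ⟨
        (a + e) % g (suc (M i)) + g (M i)     ∎)
        where
        open ≤-Reasoning
        M∉W₀ : ¬ W i₀ (M i)
        M∉W₀ W₀ = disjoint i≢i₀ (M-window i (m∸n≤m (M i) t , ≤-refl) , W₀)

    -- As `h` is at least 2 there is a class other than `i₀`, and `high` applies to its window top.
    b≤a+e : b ≤ a + e
    b≤a+e = begin
      b                          ≤⟨ m≤n+m b t ⟩
      t + b                      ≤⟨ t+b≤M i ⟩
      M i                        ≤⟨ <⇒≤ (n<g[n] (M i)) ⟩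
      g (M i)                    ≤⟨ high (Fin.punchInᵢ≢i i₀ Fin.zero) ⟩
      (a + e) % g (suc (M i))    ≤⟨ m%n≤m (a + e) (g (suc (M i))) ⟩
      a + e                      ∎
      where
      open ≤-Reasoning
      i = Fin.punchIn i₀ Fin.zero

    forced : (v : Vec ℕ h) → VecAll.All A v → Vec.sum v ≡ a + e → ∃[ k ] Vec.lookup v k ≡ a
    forced v v∈A sum≡ = from-leftover (leftover cls i₀ λ i i≢i₀ → class-used v cls v∈W
        (≤-trans (m≤m+n t b) (t+b≤M i)) (M-window i)
        (subst (λ n → g (M i) ≤ n % g (suc (M i))) (sym sum≡) (high i≢i₀)))
      where
      cls : Fin h → Fin h
      cls k = proj₁ (VecAll.lookup⁺ v∈A k)

      v∈W : ∀ k → SupportedOn (W (cls k)) (Vec.lookup v k)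
      v∈W k = adic⇒supported (proj₂ (VecAll.lookup⁺ v∈A k))

      from-leftover : ∃[ k₀ ] (Injective _≡_ _≡_ (cls ∘ Fin.punchIn k₀) × (∀ q → cls (Fin.punchIn k₀ q) ≢ i₀)) →
        ∃[ k ] Vec.lookup v k ≡ a
      from-leftover (k₀ , cls-injective , cls-avoids) = k₀ , z≡a (cls k₀ Fin.≟ i₀)
        where
        rest : Fin (suc h′) → Fin h
        rest = Fin.punchIn k₀

        z f : ℕ
        z = Vec.lookup v k₀
        f = Sum.sum (Vec.lookup v ∘ rest)

        -- The remaining summands lie in distinct classes, so they add up without carries.
        f∉W : SupportedOn (∁ (W i₀)) f
        f∉W = supported-mono {P = ⋃ _ (W ∘ cls ∘ rest)} {Q = ∁ (W i₀)} {n = f}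
          (λ { (q , Wqj) W₀j → disjoint (cls-avoids q) (Wqj , W₀j) })
          (supported-sum (W ∘ cls ∘ rest) (Vec.lookup v ∘ rest) (λ q → W? (cls (rest q)))
            (λ p≢q → disjoint (p≢q ∘ cls-injective)) (λ q → v∈W (rest q)))

        z+f : z + f ≡ a + e
        z+f = trans (sym (sum-remove {i = k₀} (Vec.lookup v))) (trans (sum-lookup v) sum≡)

        z≡a : Dec (cls k₀ ≡ i₀) → z ≡ a
        z≡a (yes cls≡) = summand-on-P (W? i₀) a∈W e∉W e-maximal a<g e<g f∉W z+f
          (subst (λ i → SupportedOn (W i) z) cls≡ (v∈W k₀))
        -- A leftover summand from another class would force `a` to be 0.
        z≡a (no cls≢) = contradiction
          (summand-off-P (W? i₀) a∈W e∉W e-maximal a<g e<g f∉W z+f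
            (supported-mono {P = W (cls k₀)} {Q = ∁ (W i₀)} {n = z}
              (λ Wj W₀j → disjoint cls≢ (Wj , W₀j)) (v∈W k₀)))
          (≢-sym (<⇒≢ (adic⇒positive a∈)))

  essential : ∀ {i₀ a} → AdicSet 𝒢 (W i₀) a → ∀ b → ∃[ n ] (b ≤ n ×
    ((v : Vec ℕ h) → VecAll.All A v → Vec.sum v ≡ n → ∃[ k ] Vec.lookup v k ≡ a))
  essential {i₀} {a} a∈ b = from-bound (maximum M)
    where
    M : Fin h → ℕ
    -- The term `t` keeps `M i ∸ t` from truncating; `b` pushes `a + e` past the threshold.
    M = proj₁ ∘ late-window (t + b)

    t+b≤M : ∀ i → t + b ≤ M i
    t+b≤M = proj₁ ∘ proj₂ ∘ late-window (t + b)

    M-window : ∀ i → Window (suc t) (M i) ⊆ W i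
    M-window i = proj₂ (proj₂ (late-window (t + b) i))

    from-bound : ∃[ c ] (∀ i → M i ≤ c) → _
    from-bound (c , M≤c) = from-complement (maximal-complement (W? i₀) L)
      where
      L : ℕ
      -- This exceeds every window top, and also `a`, so that `a < g L`.
      L = suc (c + a)

      M<L : ∀ i → M i < L
      M<L i = s≤s (≤-trans (M≤c i) (m≤m+n c a))

      a<g : a < g L
      a<g = ≤-trans (s≤s (m≤n+m a c)) (<⇒≤ (n<g[n] L))

      from-complement : ∃[ e ] (e < g L × SupportedOn (∁ (W i₀)) e
        × (∀ {j} → ¬ W i₀ j → j < L → e % g (suc j) + g j ≡ e % g j + g (suc j))) → _
      from-complement (e , e<g , e∉W , e-maximal)
        = a + e
        , b≤a+e a∈ b M t+b≤M M-window M<L a<g e<g e∉W e-maximal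
        , forced a∈ b M t+b≤M M-window M<L a<g e<g e∉W e-maximal

  -- A representation by elements of `B` of the number from `essential` is also one by elements of
  -- `A`, so it contains `a`. Hence each `a` in `A` lies in `B`.
  isMinimal : ∀ (B : ℕSet) → B ⊆ A × ¬ (A ⊆ B) → ¬ IsAsymptoticBasis h B
  isMinimal B (B⊆A , A⊈B) (b , B-basis) = A⊈B A⊆B
    where
    A⊆B : A ⊆ B
    A⊆B {a} (i , a∈) = from-essential (essential a∈ b)
      where
      from-essential : ∃[ n ] (b ≤ n ×
        ((v : Vec ℕ h) → VecAll.All A v → Vec.sum v ≡ n → ∃[ k ] Vec.lookup v k ≡ a)) → B a
      from-essential (n , b≤n , forced) =
        let v , v∈B , sum≡ = B-basis n b≤n
            k , v[k]≡a     = forced v (VecAll.map B⊆A v∈B) sum≡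
        in subst B v[k]≡a (VecAll.lookup⁺ v∈B k)

theorem3 : (h : ℕ) → 2 ≤ h →
    (t : ℕ) → 1 + ⌈log₂ h ⌉ ≤ t →
    (W : Fin h → ℕSet) → IsPartition W →
    (∀ i → ∃[ M ] (Infinite M × (∀ m → m ∈ M → 0 < m × Window t m ⊆ W i))) →
    (𝒢 : AdicSequence) →
    IsMinimalAsymptoticBasis h (AdicUnion 𝒢 W)
theorem3 (suc (suc h)) (s≤s (s≤s _)) (suc t) (s≤s log₂h≤t) W W-partition windows 𝒢 =
  Partition.isAsymptoticBasis 𝒢 W W-partition ,
  Minimality.isMinimal 𝒢 W W-partition t log₂h≤t windows
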